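{- In the simple game modeling the US legislative system, let $c_v(k)$ and $c_r(k)$ denote the number of coalitions of size $k$ in which the vice president, respectively a fixed representative, is critical. (a) If $c_v(k)=0$, then $c_r(k)=0$. (b) Suppose $k\in\mathbb{N}$ is such that $c_v(k)\ne0$, so that $270\le k\le 487$. If $270\le k\le 356$ or $380\le k\le 487$, then $c_v(k)>c_r(k)$. For the remaining $k$, i.e., $357\le k\le 379$, $c_r(k)>c_v(k)$.
   Context: The simple game modeling the US legislative system has 537 players: the president, the vice president, 100 senators and 435 representatives. The "full Senate" is the 101-element set consisting of the 100 senators and the vice president. The minimal winning coalitions are of two types: (I) the president, 51 members of the full Senate, and 218 representatives; (II) 67 senators (the vice president does not count here) and 290 representatives. A coalition (set of players) is winning iff it contains a coalition of type I or II. A player $i$ in a coalition $T$ is critical in $T$ if $T$ is winning and $T\setminus\{i\}$ is not. -}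

module Defs where

open import Data.Fin using (Fin; zero; suc)
open import Data.Fin.Subset
  using (Subset; inside; outside; ⊥; ⊤; ⁅_⁆; _∈_; _∉_; _⊆_; _∩_; _∪_; _-_; ∣_∣)
open import Data.Fin.Subset.Properties using (_∈?_; _⊆?_; anySubset?)
open import Data.List using (List; []; _∷_; _++_; map; filter; length)
open import Data.Nat using (ℕ; zero; suc; _+_; _≟_)
open import Data.Product using (_×_; ∃-syntax)
open import Data.Sum using (_⊎_)
import Data.Vec as Vec
open import Relation.Binary.PropositionalEquality using (_≡_)
open import Relation.Nullary using (¬_)
open import Relation.Nullary.Decidable using (_×-dec_; _⊎-dec_; ¬?)
open import Relation.Unary using (Decidable)

-- Player 0 is the president, 1 the vice president, 2–101 are the senators
-- and 102–536 the representatives.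

Player : Set
Player = Fin 537

Coalition : Set
Coalition = Subset 537

president vicePresident : Player
president     = zero
vicePresident = suc zero

senators fullSenate representatives : Coalition
senators        = ⊥ {2} Vec.++ ⊤ {100} Vec.++ ⊥ {435}
fullSenate      = ⁅ vicePresident ⁆ ∪ senators
representatives = ⊥ {2} Vec.++ ⊥ {100} Vec.++ ⊤ {435}

-- The president, the full Senate and the representatives partition the players,
-- so these conditions leave no room for further members of S.
TypeI : Coalition → Set
TypeI S = president ∈ S × ∣ S ∩ fullSenate ∣ ≡ 51 × ∣ S ∩ representatives ∣ ≡ 218

TypeII : Coalition → Set
TypeII S = president ∉ S × vicePresident ∉ S ×
           ∣ S ∩ senators ∣ ≡ 67 × ∣ S ∩ representatives ∣ ≡ 290

Winning : Coalition → Set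
Winning T = ∃[ S ] ((TypeI S ⊎ TypeII S) × S ⊆ T)

Critical : Player → Coalition → Set
Critical i T = i ∈ T × Winning T × ¬ Winning (T - i)

typeI? : Decidable TypeI
typeI? S = president ∈? S ×-dec ∣ S ∩ fullSenate ∣ ≟ 51
             ×-dec ∣ S ∩ representatives ∣ ≟ 218

typeII? : Decidable TypeII
typeII? S = ¬? (president ∈? S) ×-dec ¬? (vicePresident ∈? S)
              ×-dec ∣ S ∩ senators ∣ ≟ 67 ×-dec ∣ S ∩ representatives ∣ ≟ 290

winning? : Decidable Winning
winning? T = anySubset? λ S → (typeI? S ⊎-dec typeII? S) ×-dec S ⊆? T

critical? : ∀ i → Decidable (Critical i)
critical? i T = i ∈? T ×-dec winning? T ×-dec ¬? (winning? (T - i))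

-- Every subset of Fin n, each listed exactly once.
subsets : ∀ n → List (Subset n)
subsets zero    = Vec.[] ∷ []
subsets (suc n) = map (outside Vec.∷_) (subsets n) ++ map (inside Vec.∷_) (subsets n)

count : ∀ {n} {P : Subset n → Set} → Decidable P → ℕ
count {n} P? = length (filter P? (subsets n))

-- criticalCount i k is c_i(k): the number of coalitions of size k in which i
-- is critical.
criticalCount : Player → ℕ → ℕ
criticalCount i k = count λ T → ∣ T ∣ ≟ k ×-dec critical? i T

{-# OPTIONS --safe #-}

-- The vice president is critical exactly in the coalitions consisting of the president,
-- himself, 50 senators and at least 218 representatives, so
--   c_v(k) = C(100,50) C(435,k-52)  for k ≥ 270.
-- A representative is critical exactly when the representatives in the coalition number
-- 218 (with the president and at least 51 of the full Senate) or 290 (without the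
-- president and with at least 67 senators); splitting by the vice president, c_r(k) is
--   C(434,217) C(100,k-220) + C(434,217) C(100,k-219) + C(434,289) C(100,k-291) + C(434,289) C(100,k-290),
-- with each term present only if its Senate quota is met. Both counts vanish for k > 487,
-- and the remaining values of k are compared by evaluating these formulas.
module Submission where

open import Defs
open import Data.Bool using (_∧_)
open import Data.Bool.Properties using (∧-zeroʳ; ∧-identityʳ)
open import Data.Fin using (Fin; zero; suc; _↑ʳ_)
open import Data.Fin.Subset
  using (Subset; Side; inside; outside; ⊥; ⊤; _∈_; _⊆_; _∩_; _∪_; _-_; ∣_∣)
open import Data.Fin.Subset.Properties
  using ( _∈?_; p⊆q⇒∣p∣≤∣q∣; ∣⊥∣≡0; ⊥⊆; s⊆s; out⊆; drop-∷-⊆; p─⊥≡p; ∩-zeroʳ; ∩-identityʳ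
        ; ∪-identityˡ; x∈p∩q⁺; x∈p∩q⁻; ∣p∣≤∣x∷p∣)
open import Data.List as List using (List; []; _∷_; map; filter; length)
open import Data.List.Properties using (filter-++; filter-≐; length-++)
open import Data.Nat
  using (ℕ; zero; suc; _+_; _*_; _∸_; _≤_; _<_; _>_; s≤s; s≤s⁻¹; _≟_; _≤?_; _<?_)
open import Data.Nat.Combinatorics using (_C_; nCk+nC[k+1]≡[n+1]C[k+1]; k>n⇒nCk≡0)
open import Data.Nat.Properties
open import Data.Product using (_×_; _,_; proj₁; proj₂; ∃-syntax; map₂)
open import Data.Sum using (_⊎_; inj₁; inj₂; [_,_]′)
open import Data.Vec using ([]; _∷_; _++_; here; there; splitAt)
open import Data.Vec.Properties using (zipWith-++)
open import Function using (_∘_; _⇔_; mk⇔; Equivalence)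
open import Relation.Binary.PropositionalEquality
  using (_≡_; _≢_; refl; sym; trans; cong; cong₂; subst; module ≡-Reasoning)
open import Relation.Nullary using (¬_; Dec; yes; no; contradiction)
open import Relation.Nullary.Decidable using (_×-dec_; _⊎-dec_; _→-dec_; ¬?; from-yes)
open import Relation.Unary using (Decidable)

open Equivalence using (to; from)

private
  variable
    m n : ℕ

-- Counting subsets with prescribed size or member.

count-cong : {P Q : Subset n → Set} (P? : Decidable P) (Q? : Decidable Q) →
             (∀ S → P S ⇔ Q S) → count P? ≡ count Q?
count-cong P? Q? P⇔Q =
  cong length (filter-≐ P? Q? ((λ {S} → to (P⇔Q S)) , (λ {S} → from (P⇔Q S))) (subsets _))

length-filter-map : {A B : Set} {P : B → Set} (P? : Decidable P) (f : A → B) (xs : List A) →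
                    length (filter P? (map f xs)) ≡ length (filter (P? ∘ f) xs)
length-filter-map P? f [] = refl
length-filter-map P? f (x ∷ xs) with P? (f x)
... | yes _ = cong suc (length-filter-map P? f xs)
... | no  _ = length-filter-map P? f xs

count-none : {P : Subset n → Set} (P? : Decidable P) → (∀ S → ¬ P S) → count P? ≡ 0
count-none P? ¬P = none (subsets _)
  where
  none : ∀ xs → length (filter P? xs) ≡ 0
  none []       = refl
  none (S ∷ xs) with P? S
  ... | yes p = contradiction p (¬P S)
  ... | no  _ = none xs

count-suc : {P : Subset (suc n) → Set} (P? : Decidable P) →
            count P? ≡ count (P? ∘ (outside ∷_)) + count (P? ∘ (inside ∷_))
count-suc {n} P? = begin
  length (filter P? (outs List.++ ins))
    ≡⟨ cong length (filter-++ P? outs ins) ⟩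
  length (filter P? outs List.++ filter P? ins)
    ≡⟨ length-++ (filter P? outs) ⟩
  length (filter P? outs) + length (filter P? ins)
    ≡⟨ cong₂ _+_ (length-filter-map P? (outside ∷_) (subsets n))
                 (length-filter-map P? (inside ∷_) (subsets n)) ⟩
  count (P? ∘ (outside ∷_)) + count (P? ∘ (inside ∷_)) ∎
  where
  open ≡-Reasoning
  outs = map (outside ∷_) (subsets n)
  ins  = map (inside ∷_) (subsets n)

-- The counts on the right are replaced by variables so that no instance of the lemma
-- makes the type checker enumerate the subsets of a large Fin n.
count-× : {P : Subset m → Set} {Q : Subset n → Set} {R : Subset (m + n) → Set}
          (P? : Decidable P) (Q? : Decidable Q) (R? : Decidable R) →
          (∀ xs ys → R (xs ++ ys) ⇔ (P xs × Q ys)) →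
          {a b : ℕ} → count P? ≡ a → count Q? ≡ b → count R? ≡ a * b
count-× {zero} P? Q? R? R⇔ refl refl with P? []
... | yes p = trans (count-cong R? Q? λ ys → mk⇔ (proj₂ ∘ to (R⇔ [] ys)) (from (R⇔ [] ys) ∘ (p ,_)))
                    (sym (+-identityʳ _))
... | no ¬p = count-none R? λ ys → ¬p ∘ proj₁ ∘ to (R⇔ [] ys)
count-× {suc m} P? Q? R? R⇔ refl refl = begin
  count R?
    ≡⟨ count-suc R? ⟩
  count (R? ∘ (outside ∷_)) + count (R? ∘ (inside ∷_))
    ≡⟨ cong₂ _+_ (count-× (P? ∘ (outside ∷_)) Q? (R? ∘ (outside ∷_)) (R⇔ ∘ (outside ∷_)) refl refl)
                 (count-× (P? ∘ (inside ∷_)) Q? (R? ∘ (inside ∷_)) (R⇔ ∘ (inside ∷_)) refl refl) ⟩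
  count (P? ∘ (outside ∷_)) * count Q? + count (P? ∘ (inside ∷_)) * count Q?
    ≡⟨ *-distribʳ-+ (count Q?) (count (P? ∘ (outside ∷_))) _ ⟨
  (count (P? ∘ (outside ∷_)) + count (P? ∘ (inside ∷_))) * count Q?
    ≡⟨ cong (_* count Q?) (count-suc P?) ⟨
  count P? * count Q? ∎
  where open ≡-Reasoning

-- Splitting on the first element turns the count into Pascal's rule.
count-size : ∀ n k → count {n} (λ S → ∣ S ∣ ≟ k) ≡ n C k
count-size zero    zero    = refl
count-size zero    (suc k) = refl
count-size (suc n) zero    = trans (count-suc {n} (λ S → ∣ S ∣ ≟ 0))
  (cong₂ _+_ (count-size n 0) (count-none {n} (λ S → suc ∣ S ∣ ≟ 0) λ _ ()))
count-size (suc n) (suc k) = begin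
  count {suc n} (λ S → ∣ S ∣ ≟ suc k)
    ≡⟨ count-suc {n} (λ S → ∣ S ∣ ≟ suc k) ⟩
  count {n} (λ S → ∣ S ∣ ≟ suc k) + count {n} (λ S → suc ∣ S ∣ ≟ suc k)
    ≡⟨ cong₂ _+_ (count-size n (suc k))
         (trans (count-cong {n} (λ S → suc ∣ S ∣ ≟ suc k) (λ S → ∣ S ∣ ≟ k)
                            (λ _ → mk⇔ suc-injective (cong suc)))
                (count-size n k)) ⟩
  n C suc k + n C k
    ≡⟨ +-comm (n C suc k) (n C k) ⟩
  n C k + n C suc k
    ≡⟨ nCk+nC[k+1]≡[n+1]C[k+1] n k ⟩
  suc n C suc k ∎
  where open ≡-Reasoning

∣p∣≡1+∣p-x∣ : ∀ {x} {p : Subset n} → x ∈ p → ∣ p ∣ ≡ suc ∣ p - x ∣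
-- `p - x` is the difference with a singleton; when `x` is the head, what is removed from the tail
-- is `⊥`.
∣p∣≡1+∣p-x∣ {p = _ ∷ p}       here        = cong (suc ∘ ∣_∣) (sym (p─⊥≡p p))
∣p∣≡1+∣p-x∣ {p = inside ∷ _}  (there x∈p) = cong suc (∣p∣≡1+∣p-x∣ x∈p)
∣p∣≡1+∣p-x∣ {p = outside ∷ _} (there x∈p) = ∣p∣≡1+∣p-x∣ x∈p

-- Removing `j` leaves an arbitrary `k`-subset of the other `n` elements. The induction moves `j`
-- towards the head and again uses Pascal's rule.
count-∋-size : ∀ {n} (j : Fin (suc n)) k →
               count (λ S → j ∈? S ×-dec ∣ S ∣ ≟ suc k) ≡ n C k
count-∋-size {n} zero k = trans (count-suc {n} (λ S → zero ∈? S ×-dec ∣ S ∣ ≟ suc k))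
  (cong₂ _+_ (count-none {n} (λ S → zero ∈? (outside ∷ S) ×-dec ∣ S ∣ ≟ suc k) λ { _ (() , _) })
    (trans (count-cong {n} (λ S → zero ∈? (inside ∷ S) ×-dec suc ∣ S ∣ ≟ suc k) (λ S → ∣ S ∣ ≟ k)
                       (λ _ → mk⇔ (suc-injective ∘ proj₂) (λ eq → here , cong suc eq)))
           (count-size n k)))
count-∋-size {suc n} (suc j) k = begin
  count (λ S → suc j ∈? S ×-dec ∣ S ∣ ≟ suc k)
    ≡⟨ count-suc (λ S → suc j ∈? S ×-dec ∣ S ∣ ≟ suc k) ⟩
  count (λ S → suc j ∈? (outside ∷ S) ×-dec ∣ S ∣ ≟ suc k) +
  count (λ S → suc j ∈? (inside ∷ S) ×-dec suc ∣ S ∣ ≟ suc k)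
    ≡⟨ cong₂ _+_
         (count-cong (λ S → suc j ∈? (outside ∷ S) ×-dec ∣ S ∣ ≟ suc k)
                     (λ S → j ∈? S ×-dec ∣ S ∣ ≟ suc k)
                     (λ _ → mk⇔ (λ { (there j∈S , eq) → j∈S , eq }) (λ { (j∈S , eq) → there j∈S , eq })))
         (count-cong (λ S → suc j ∈? (inside ∷ S) ×-dec suc ∣ S ∣ ≟ suc k)
                     (λ S → j ∈? S ×-dec ∣ S ∣ ≟ k)
                     (λ _ → mk⇔ (λ { (there j∈S , eq) → j∈S , suc-injective eq })
                                (λ { (j∈S , eq) → there j∈S , cong suc eq }))) ⟩
  count (λ S → j ∈? S ×-dec ∣ S ∣ ≟ suc k) + count (λ S → j ∈? S ×-dec ∣ S ∣ ≟ k)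
    ≡⟨ pascal k ⟩
  suc n C k ∎
  where
  open ≡-Reasoning
  pascal : ∀ k → count (λ S → j ∈? S ×-dec ∣ S ∣ ≟ suc k) + count (λ S → j ∈? S ×-dec ∣ S ∣ ≟ k) ≡ suc n C k
  -- The induction hypothesis does not cover size 0, but a subset containing `j` is nonempty.
  pascal zero    = cong₂ _+_ (count-∋-size j 0)
    (count-none (λ S → j ∈? S ×-dec ∣ S ∣ ≟ 0) λ { _ (j∈S , eq) → 0≢1+n (trans (sym eq) (∣p∣≡1+∣p-x∣ j∈S)) })
  pascal (suc k) = trans (cong₂ _+_ (count-∋-size j (suc k)) (count-∋-size j k))
    (trans (+-comm (n C suc k) (n C k)) (nCk+nC[k+1]≡[n+1]C[k+1] n k))

m+n≤o⇒n≤o∸m : ∀ m {n o} → m + n ≤ o → n ≤ o ∸ m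
m+n≤o⇒n≤o∸m m {n} {o} le = m+n≤o⇒m≤o∸n n (subst (_≤ o) (+-comm m n) le)

-- Ways to complete `c` players already chosen to a coalition of size `k` by at least `q` members of
-- an `n`-element block. The test also ensures that `k ∸ c` is never truncated.
#≥ : (n q c k : ℕ) → ℕ
#≥ n q c k with c + q ≤? k
... | yes _ = n C (k ∸ c)
... | no  _ = 0

count-≥ : ∀ n q c k → count {n} (λ S → q ≤? ∣ S ∣ ×-dec c + ∣ S ∣ ≟ k) ≡ #≥ n q c k
count-≥ n q c k with c + q ≤? k
... | yes c+q≤k = trans
  (count-cong {n} (λ S → q ≤? ∣ S ∣ ×-dec c + ∣ S ∣ ≟ k) (λ S → ∣ S ∣ ≟ k ∸ c) λ S →
    mk⇔ (λ { (_ , refl) → sym (m+n∸m≡n c ∣ S ∣) })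
        (λ { eq → subst (q ≤_) (sym eq) (m+n≤o⇒n≤o∸m c c+q≤k)
                , trans (cong (c +_) eq) (m+[n∸m]≡n (m+n≤o⇒m≤o c c+q≤k)) }))
  (count-size n (k ∸ c))
... | no  c+q≰k = count-none {n} (λ S → q ≤? ∣ S ∣ ×-dec c + ∣ S ∣ ≟ k)
  λ { S (q≤ , refl) → c+q≰k (+-monoʳ-≤ c q≤) }

#≥-vanishes : ∀ n q c {k} → c + n < k → #≥ n q c k ≡ 0
#≥-vanishes n q c {k} c+n<k with c + q ≤? k
... | yes _ = k>n⇒nCk≡0 (m+n≤o⇒n≤o∸m c (subst (_≤ k) (sym (+-suc c n)) c+n<k))
... | no  _ = refl

-- Concatenated subsets: sizes, inclusion, deletion.

∣p++q∣ : (p : Subset m) (q : Subset n) → ∣ p ++ q ∣ ≡ ∣ p ∣ + ∣ q ∣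
∣p++q∣ []            q = refl
∣p++q∣ (inside ∷ p)  q = cong suc (∣p++q∣ p q)
∣p++q∣ (outside ∷ p) q = ∣p++q∣ p q

∣p++q∩⊤++⊥∣ : (p : Subset m) (q : Subset n) → ∣ (p ++ q) ∩ (⊤ {m} ++ ⊥ {n}) ∣ ≡ ∣ p ∣
∣p++q∩⊤++⊥∣ {m} {n} p q = begin
  ∣ (p ++ q) ∩ (⊤ {m} ++ ⊥ {n}) ∣ ≡⟨ cong ∣_∣ (zipWith-++ _∧_ p q (⊤ {m}) (⊥ {n})) ⟩
  ∣ (p ∩ ⊤) ++ (q ∩ ⊥) ∣      ≡⟨ cong₂ (λ x y → ∣ x ++ y ∣) (∩-identityʳ p) (∩-zeroʳ q) ⟩
  ∣ p ++ ⊥ {n} ∣              ≡⟨ ∣p++q∣ p ⊥ ⟩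
  ∣ p ∣ + ∣ ⊥ {n} ∣           ≡⟨ cong (∣ p ∣ +_) (∣⊥∣≡0 n) ⟩
  ∣ p ∣ + 0                   ≡⟨ +-identityʳ ∣ p ∣ ⟩
  ∣ p ∣                       ∎
  where open ≡-Reasoning

∣p++q∩⊥++⊤∣ : (p : Subset m) (q : Subset n) → ∣ (p ++ q) ∩ (⊥ {m} ++ ⊤ {n}) ∣ ≡ ∣ q ∣
∣p++q∩⊥++⊤∣ {m} {n} p q = begin
  ∣ (p ++ q) ∩ (⊥ {m} ++ ⊤ {n}) ∣ ≡⟨ cong ∣_∣ (zipWith-++ _∧_ p q (⊥ {m}) (⊤ {n})) ⟩
  ∣ (p ∩ ⊥) ++ (q ∩ ⊤) ∣      ≡⟨ cong₂ (λ x y → ∣ x ++ y ∣) (∩-zeroʳ p) (∩-identityʳ q) ⟩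
  ∣ ⊥ {m} ++ q ∣              ≡⟨ ∣p++q∣ (⊥ {m}) q ⟩
  ∣ ⊥ {m} ∣ + ∣ q ∣           ≡⟨ cong (_+ ∣ q ∣) (∣⊥∣≡0 m) ⟩
  ∣ q ∣                       ∎
  where open ≡-Reasoning

++-mono-⊆ : {p p′ : Subset m} {q q′ : Subset n} → p ⊆ p′ → q ⊆ q′ → p ++ q ⊆ p′ ++ q′
++-mono-⊆ {p = []}    {[]}    p⊆p′ q⊆q′ x∈q         = q⊆q′ x∈q
++-mono-⊆ {p = _ ∷ _} {_ ∷ _} p⊆p′ q⊆q′ here        with here ← p⊆p′ here = here
++-mono-⊆ {p = _ ∷ _} {_ ∷ _} p⊆p′ q⊆q′ (there x∈p) = there (++-mono-⊆ (drop-∷-⊆ p⊆p′) q⊆q′ x∈p)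

∈-++ʳ : (p : Subset m) {q : Subset n} {j : Fin n} → (m ↑ʳ j) ∈ (p ++ q) ⇔ j ∈ q
∈-++ʳ []      = mk⇔ (λ j∈ → j∈) (λ j∈ → j∈)
∈-++ʳ (_ ∷ p) = mk⇔ (λ { (there j∈) → to (∈-++ʳ p) j∈ }) (there ∘ from (∈-++ʳ p))

++-minusʳ : (p : Subset m) (q : Subset n) (j : Fin n) → (p ++ q) - (m ↑ʳ j) ≡ p ++ (q - j)
++-minusʳ []      q j = refl
++-minusʳ (x ∷ p) q j = cong (x ∷_) (++-minusʳ p q j)

subset-of-size : (p : Subset n) {k : ℕ} → k ≤ ∣ p ∣ → ∃[ q ] (q ⊆ p × ∣ q ∣ ≡ k)
subset-of-size {n} p {zero} _ = ⊥ , ⊥⊆ , ∣⊥∣≡0 n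
subset-of-size (outside ∷ p) {suc k} k≤ with q , q⊆p , eq ← subset-of-size p k≤ =
  outside ∷ q , s⊆s q⊆p , eq
subset-of-size (inside ∷ p) {suc k} (s≤s k≤) with q , q⊆p , eq ← subset-of-size p k≤ =
  inside ∷ q , s⊆s q⊆p , cong suc eq

∣∷∣-cong : ∀ x (p : Subset m) (q : Subset n) → ∣ p ∣ ≡ ∣ q ∣ → ∣ x ∷ p ∣ ≡ ∣ x ∷ q ∣
∣∷∣-cong inside  _ _ = cong suc
∣∷∣-cong outside _ _ = λ eq → eq

-- Winning coalitions as thresholds on block sizes.

-- The second alternative leaves `p` and `v` free because a winning coalition stays winning when
-- players join it.
MeetsQuota : Side → Side → Subset m → Subset n → Set
MeetsQuota p v s ρ = (p ≡ inside × 51 ≤ ∣ v ∷ s ∣ × 218 ≤ ∣ ρ ∣) ⊎ (67 ≤ ∣ s ∣ × 290 ≤ ∣ ρ ∣)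

module _ (p v : Side) (s : Subset 100) (ρ : Subset 435) where

  private
    T : Coalition
    T = p ∷ v ∷ (s ++ ρ)

  ∣T∩fullSenate∣ : ∣ T ∩ fullSenate ∣ ≡ ∣ v ∷ s ∣
  ∣T∩fullSenate∣ = begin
    ∣ T ∩ fullSenate ∣
      -- The first two entries of `fullSenate` are `outside` and `inside`, so `p` is erased and `v`
      -- is kept.
      ≡⟨ cong₂ (λ x y → ∣ x ∷ y ∷ (s ++ ρ) ∩ (⊥ ∪ (⊤ {100} ++ ⊥ {435})) ∣) (∧-zeroʳ p) (∧-identityʳ v) ⟩
    ∣ v ∷ (s ++ ρ) ∩ (⊥ ∪ (⊤ {100} ++ ⊥ {435})) ∣
      ≡⟨ cong (λ x → ∣ v ∷ (s ++ ρ) ∩ x ∣) (∪-identityˡ (⊤ {100} ++ ⊥ {435})) ⟩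
    ∣ v ∷ (s ++ ρ) ∩ (⊤ {100} ++ ⊥ {435}) ∣
      ≡⟨ ∣∷∣-cong v ((s ++ ρ) ∩ (⊤ {100} ++ ⊥ {435})) s (∣p++q∩⊤++⊥∣ s ρ) ⟩
    ∣ v ∷ s ∣ ∎
    where
    open ≡-Reasoning
  ∣T∩senators∣ : ∣ T ∩ senators ∣ ≡ ∣ s ∣
  ∣T∩senators∣ = trans
    (cong₂ (λ x y → ∣ x ∷ y ∷ (s ++ ρ) ∩ (⊤ {100} ++ ⊥ {435}) ∣) (∧-zeroʳ p) (∧-zeroʳ v))
    (∣p++q∩⊤++⊥∣ s ρ)

  ∣T∩representatives∣ : ∣ T ∩ representatives ∣ ≡ ∣ ρ ∣
  ∣T∩representatives∣ = trans
    (cong₂ (λ x y → ∣ x ∷ y ∷ (s ++ ρ) ∩ (⊥ {100} ++ ⊤ {435}) ∣) (∧-zeroʳ p) (∧-zeroʳ v))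
    (∣p++q∩⊥++⊤∣ s ρ)

∩-monoˡ-⊆ : {p q : Subset n} (r : Subset n) → p ⊆ q → p ∩ r ⊆ q ∩ r
∩-monoˡ-⊆ {p = p} r p⊆q x∈ with x∈p , x∈r ← x∈p∩q⁻ p r x∈ = x∈p∩q⁺ (p⊆q x∈p , x∈r)

-- Intersecting with a block is monotone, which gives the thresholds. Conversely, each block can be
-- shrunk to exactly its quota, and the pieces form a minimal winning coalition.
winning⇔meetsQuota : ∀ p v (s : Subset 100) (ρ : Subset 435) →
                     Winning (p ∷ v ∷ (s ++ ρ)) ⇔ MeetsQuota p v s ρ
winning⇔meetsQuota p v s ρ = mk⇔ ⇒ ⇐
  where
  T : Coalition
  T = p ∷ v ∷ (s ++ ρ)

  bound : ∀ {q t} {S : Coalition} (B : Coalition) →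
          S ⊆ T → ∣ S ∩ B ∣ ≡ q → ∣ T ∩ B ∣ ≡ t → q ≤ t
  bound {S = S} B S⊆T refl refl = p⊆q⇒∣p∣≤∣q∣ (∩-monoˡ-⊆ {p = S} {T} B S⊆T)

  president∈⇒inside : president ∈ T → p ≡ inside
  president∈⇒inside here = refl

  ⇒ : Winning T → MeetsQuota p v s ρ
  ⇒ (S , inj₁ (pr , f , r) , S⊆T) = inj₁
    ( president∈⇒inside (S⊆T pr)
    , bound {S = S} fullSenate S⊆T f (∣T∩fullSenate∣ p v s ρ)
    , bound {S = S} representatives S⊆T r (∣T∩representatives∣ p v s ρ))
  ⇒ (S , inj₂ (_ , _ , f , r) , S⊆T) = inj₂
    ( bound {S = S} senators S⊆T f (∣T∩senators∣ p v s ρ)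
    , bound {S = S} representatives S⊆T r (∣T∩representatives∣ p v s ρ))

  ⇐ : MeetsQuota p v s ρ → Winning T
  ⇐ (inj₁ (refl , f , r))
    -- The full Senate is shrunk as one block, so `v′` may or may not contain the vice president.
    with v′ ∷ s′ , vs⊆ , f≡ ← subset-of-size (v ∷ s) f
       | ρ′ , ρ⊆ , r≡ ← subset-of-size ρ r =
    inside ∷ v′ ∷ (s′ ++ ρ′)
    , inj₁ (here , trans (∣T∩fullSenate∣ inside v′ s′ ρ′) f≡ , trans (∣T∩representatives∣ inside v′ s′ ρ′) r≡)
    , s⊆s (++-mono-⊆ {p = v′ ∷ s′} {v ∷ s} vs⊆ ρ⊆)
  ⇐ (inj₂ (f , r))
    with s′ , s⊆ , f≡ ← subset-of-size s f
       | ρ′ , ρ⊆ , r≡ ← subset-of-size ρ r =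
    outside ∷ outside ∷ (s′ ++ ρ′)
    , inj₂ ( (λ ()) , (λ { (there ()) }) , trans (∣T∩senators∣ outside outside s′ ρ′) f≡
           , trans (∣T∩representatives∣ outside outside s′ ρ′) r≡)
    , out⊆ (out⊆ (++-mono-⊆ s⊆ ρ⊆))

-- Characterizations of critical players.

-- The vice president counts only towards the quota of 51. So the coalition must win by type I with
-- that quota met exactly, and 50 senators also rule out type II.
critical-vicePresident⇔ : ∀ p v (s : Subset 100) (ρ : Subset 435) →
  Critical vicePresident (p ∷ v ∷ (s ++ ρ)) ⇔ (p ≡ inside × v ≡ inside × ∣ s ∣ ≡ 50 × 218 ≤ ∣ ρ ∣)
critical-vicePresident⇔ p v s ρ = mk⇔ ⇒ ⇐
  where
  T : Coalition
  T = p ∷ v ∷ (s ++ ρ)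

  T-v : T - vicePresident ≡ p ∷ outside ∷ (s ++ ρ)
  T-v = cong (λ x → p ∷ outside ∷ x) (p─⊥≡p (s ++ ρ))

  winning-v⇔ : Winning (T - vicePresident) ⇔ MeetsQuota p outside s ρ
  winning-v⇔ = subst (λ S → Winning S ⇔ MeetsQuota p outside s ρ) (sym T-v)
                     (winning⇔meetsQuota p outside s ρ)

  ⇒ : Critical vicePresident T → p ≡ inside × v ≡ inside × ∣ s ∣ ≡ 50 × 218 ≤ ∣ ρ ∣
  ⇒ (there here , win , ¬win) with to (winning⇔meetsQuota p v s ρ) win
  ... | inj₁ (refl , s≤s 50≤ , 218≤) = refl , refl , ≤-antisym ≤50 50≤ , 218≤
    where
    ≤50 : ∣ s ∣ ≤ 50
    ≤50 = ≮⇒≥ λ 51≤ → ¬win (from winning-v⇔ (inj₁ (refl , 51≤ , 218≤)))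
  ... | inj₂ q = contradiction (from winning-v⇔ (inj₂ q)) ¬win

  ⇐ : p ≡ inside × v ≡ inside × ∣ s ∣ ≡ 50 × 218 ≤ ∣ ρ ∣ → Critical vicePresident T
  ⇐ (refl , refl , s≡50 , 218≤) =
    there here
    , from (winning⇔meetsQuota p v s ρ) (inj₁ (refl , s≤s (≤-reflexive (sym s≡50)) , 218≤))
    , λ win → case (to winning-v⇔ win)
    where
    case : ¬ MeetsQuota p outside s ρ
    case (inj₁ (_ , 51≤ , _)) = <⇒≢ 51≤ (sym s≡50)
    case (inj₂ (67≤ , _))     = <⇒≢ (≤-trans (m≤m+n 51 16) 67≤) (sym s≡50)

-- The second alternative excludes the president: with him, a coalition meeting the type II quotas
-- also wins by type I and can spare any representative.
BareQuota : Side → Side → Subset m → Subset n → Set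
BareQuota p v s ρ = (p ≡ inside × 51 ≤ ∣ v ∷ s ∣ × ∣ ρ ∣ ≡ 218) ⊎ (p ≡ outside × 67 ≤ ∣ s ∣ × ∣ ρ ∣ ≡ 290)

critical-representative⇔ : ∀ (j : Fin 435) p v (s : Subset 100) (ρ : Subset 435) →
  Critical (suc (suc (100 ↑ʳ j))) (p ∷ v ∷ (s ++ ρ)) ⇔
  (j ∈ ρ × BareQuota p v s ρ)
critical-representative⇔ j p v s ρ = mk⇔ ⇒ ⇐
  where
  r : Player
  r = suc (suc (100 ↑ʳ j))

  T : Coalition
  T = p ∷ v ∷ (s ++ ρ)

  winning-r⇔ : Winning (T - r) ⇔ MeetsQuota p v s (ρ - j)
  winning-r⇔ = subst (λ S → Winning S ⇔ MeetsQuota p v s (ρ - j))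
                     (sym (cong (λ x → p ∷ v ∷ x) (++-minusʳ s ρ j)))
                     (winning⇔meetsQuota p v s (ρ - j))

  -- A quota that is met with `j` and missed without `j` is met exactly.
  exact : ∀ {q} → j ∈ ρ → suc q ≤ ∣ ρ ∣ → ¬ suc q ≤ ∣ ρ - j ∣ → ∣ ρ ∣ ≡ suc q
  exact j∈ q< q≮ = ≤-antisym (≤-trans (≤-reflexive (∣p∣≡1+∣p-x∣ j∈)) (≰⇒> q≮)) q<

  ⇒ : Critical r T → j ∈ ρ × BareQuota p v s ρ
  ⇒ (there (there r∈) , win , ¬win) = j∈ρ , bare p refl (to (winning⇔meetsQuota p v s ρ) win)
    where
    j∈ρ : j ∈ ρ
    j∈ρ = to (∈-++ʳ s) r∈

    bare : ∀ x → p ≡ x → MeetsQuota p v s ρ → BareQuota p v s ρ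
    bare _ _ (inj₁ (refl , 51≤ , 218≤)) =
      inj₁ (refl , 51≤ , exact j∈ρ 218≤ λ lt → ¬win (from winning-r⇔ (inj₁ (refl , 51≤ , lt))))
    bare outside eq (inj₂ (67≤ , 290≤)) =
      inj₂ (eq , 67≤ , exact j∈ρ 290≤ λ lt → ¬win (from winning-r⇔ (inj₂ (67≤ , lt))))
    -- After losing `j` there remain at least 289 = 218 + 71 representatives and 67 = 51 + 16
    -- senators, so type I still holds.
    bare inside eq (inj₂ (67≤ , 290≤)) = contradiction
      (from winning-r⇔ (inj₁ (eq , ≤-trans (m≤m+n 51 16) (≤-trans 67≤ (∣p∣≤∣x∷p∣ v s))
                                 , ≤-trans (m≤m+n 218 71) (s≤s⁻¹ (subst (290 ≤_) (∣p∣≡1+∣p-x∣ j∈ρ) 290≤)))))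
      ¬win

  ⇐ : j ∈ ρ × BareQuota p v s ρ → Critical r T
  ⇐ (j∈ρ , bare) = there (there (from (∈-++ʳ s) j∈ρ))
                    , from (winning⇔meetsQuota p v s ρ) (meets bare)
                    , λ win → fails bare (to winning-r⇔ win)
    where
    meets : BareQuota p v s ρ → MeetsQuota p v s ρ
    meets (inj₁ (eq , 51≤ , ρ≡)) = inj₁ (eq , 51≤ , ≤-reflexive (sym ρ≡))
    meets (inj₂ (eq , 67≤ , ρ≡)) = inj₂ (67≤ , ≤-reflexive (sym ρ≡))

    short : ∀ {q} → ∣ ρ ∣ ≤ q → ¬ q ≤ ∣ ρ - j ∣
    short ρ≤ q≤ = <-irrefl refl (≤-trans (≤-reflexive (sym (∣p∣≡1+∣p-x∣ j∈ρ))) (≤-trans ρ≤ q≤))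

    fails : BareQuota p v s ρ → ¬ MeetsQuota p v s (ρ - j)
    fails (inj₁ (_ , _ , ρ≡)) (inj₁ (_ , _ , 218≤)) = short (≤-reflexive ρ≡) 218≤
    -- With only 218 = 290 - 72 representatives, type II is out of reach.
    fails (inj₁ (_ , _ , ρ≡)) (inj₂ (_ , 290≤)) = short (≤-reflexive ρ≡) (≤-trans (m≤m+n 218 72) 290≤)
    fails (inj₂ (refl , _)) (inj₁ (() , _))
    fails (inj₂ (_ , _ , ρ≡)) (inj₂ (_ , 290≤)) = short (≤-reflexive ρ≡) 290≤

-- Closed formulas for the two counts.

count-quadrants : {P : Subset (suc (suc n)) → Set} (P? : Decidable P) {a b c d : ℕ} →
  count (λ S → P? (outside ∷ outside ∷ S)) ≡ a → count (λ S → P? (outside ∷ inside ∷ S)) ≡ b →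
  count (λ S → P? (inside ∷ outside ∷ S)) ≡ c → count (λ S → P? (inside ∷ inside ∷ S)) ≡ d →
  count P? ≡ (a + b) + (c + d)
count-quadrants P? refl refl refl refl =
  trans (count-suc P?) (cong₂ _+_ (count-suc (P? ∘ (outside ∷_))) (count-suc (P? ∘ (inside ∷_))))

-- The offset 52 stands for the president, the vice president and 50 senators.
c-v-formula : ℕ → ℕ
c-v-formula k = (100 C 50) * #≥ 435 218 52 k

-- Stated for a variable decision procedure crit?: the type checker would otherwise
-- unfold winning? and search all coalitions.
count-critical-vicePresident : ∀ k (crit? : Decidable λ T → ∣ T ∣ ≡ k × Critical vicePresident T) →
                               count crit? ≡ c-v-formula k
count-critical-vicePresident k crit? = count-quadrants crit?
    (count-none (λ S → crit? (outside ∷ outside ∷ S)) λ { _ (_ , there () , _) })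
    (count-none (λ S → crit? (outside ∷ inside ∷ S)) without-president)
    (count-none (λ S → crit? (inside ∷ outside ∷ S)) λ { _ (_ , there () , _) })
    (count-× (λ s → ∣ s ∣ ≟ 50) (λ ρ → 218 ≤? ∣ ρ ∣ ×-dec 52 + ∣ ρ ∣ ≟ k)
             (λ S → crit? (inside ∷ inside ∷ S)) splits (count-size 100 50) (count-≥ 435 218 52 k))
  where
  without-president : ∀ S → ¬ (∣ outside ∷ inside ∷ S ∣ ≡ k × Critical vicePresident (outside ∷ inside ∷ S))
  without-president S (_ , crit) with s , ρ , refl ← splitAt 100 S
    with () ← proj₁ (to (critical-vicePresident⇔ outside inside s ρ) crit)

  splits : ∀ s ρ → (∣ inside ∷ inside ∷ (s ++ ρ) ∣ ≡ k × Critical vicePresident (inside ∷ inside ∷ (s ++ ρ))) ⇔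
                   (∣ s ∣ ≡ 50 × 218 ≤ ∣ ρ ∣ × 52 + ∣ ρ ∣ ≡ k)
  splits s ρ = mk⇔
    (λ { (size , crit) → let _ , _ , s≡ , 218≤ = to critical⇔ crit in
                         s≡ , 218≤ , trans (sym (total s≡)) size })
    (λ { (s≡ , 218≤ , size) → trans (total s≡) size , from critical⇔ (refl , refl , s≡ , 218≤) })
    where
    critical⇔ = critical-vicePresident⇔ inside inside s ρ
    total : ∣ s ∣ ≡ 50 → ∣ inside ∷ inside ∷ (s ++ ρ) ∣ ≡ 52 + ∣ ρ ∣
    total s≡ = trans (cong (2 +_) (∣p++q∣ s ρ)) (cong (λ x → 2 + (x + ∣ ρ ∣)) s≡)

-- The summands follow the order of `count-quadrants`. Each offset is the number of representatives
-- plus those present among president and vice president; 289 and 217 are one below the quotas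
-- because the fixed representative is already in. In the last summand the vice president fills one
-- of the 51 seats.
c-r-formula : ℕ → ℕ
c-r-formula k = (#≥ 100 67 290 k * (434 C 289) + #≥ 100 67 291 k * (434 C 289)) +
        (#≥ 100 51 219 k * (434 C 217) + #≥ 100 50 220 k * (434 C 217))

count-critical-representative :
  ∀ j k (crit? : Decidable λ T → ∣ T ∣ ≡ k × Critical (suc (suc (100 ↑ʳ j))) T) →
  count crit? ≡ c-r-formula k
count-critical-representative j k crit? = count-quadrants crit?
    (quadrant outside outside 67 0 289 (λ _ → refl) λ _ _ →
      mk⇔ (λ { (inj₁ (() , _)); (inj₂ (_ , q)) → q }) (inj₂ ∘ (refl ,_)))
    (quadrant outside inside  67 1 289 (λ _ → refl) λ _ _ →
      mk⇔ (λ { (inj₁ (() , _)); (inj₂ (_ , q)) → q }) (inj₂ ∘ (refl ,_)))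
    (quadrant inside outside 51 1 217 (λ _ → refl) λ _ _ →
      mk⇔ (λ { (inj₁ (_ , q)) → q; (inj₂ (() , _)) }) (inj₁ ∘ (refl ,_)))
    (quadrant inside inside  50 2 217 (λ _ → refl) λ _ _ →
      mk⇔ (λ { (inj₁ (_ , s≤s q , e)) → q , e })
          (λ { (q , e) → inj₁ (refl , s≤s q , e) }))
  where
  r : Player
  r = suc (suc (100 ↑ʳ j))

  -- Here `e` counts the president and vice president present. As the number of representatives is
  -- fixed at `suc b`, the total size constrains only the senators, and the count factors.
  quadrant : ∀ p v q e b → (∀ (S : Subset 535) → ∣ p ∷ v ∷ S ∣ ≡ e + ∣ S ∣) →
             (∀ (s : Subset 100) (ρ : Subset 435) → BareQuota p v s ρ ⇔ (q ≤ ∣ s ∣ × ∣ ρ ∣ ≡ suc b)) →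
             count (λ S → crit? (p ∷ v ∷ S)) ≡ #≥ 100 q (e + suc b) k * (434 C b)
  quadrant p v q e b size bare⇔ =
    count-× (λ s → q ≤? ∣ s ∣ ×-dec (e + suc b) + ∣ s ∣ ≟ k) (λ ρ → j ∈? ρ ×-dec ∣ ρ ∣ ≟ suc b)
             (λ S → crit? (p ∷ v ∷ S)) splits
            (count-≥ 100 q (e + suc b) k) (count-∋-size {434} j b)
    where
    splits : ∀ s ρ → (∣ p ∷ v ∷ (s ++ ρ) ∣ ≡ k × Critical r (p ∷ v ∷ (s ++ ρ))) ⇔
                     ((q ≤ ∣ s ∣ × (e + suc b) + ∣ s ∣ ≡ k) × (j ∈ ρ × ∣ ρ ∣ ≡ suc b))
    splits s ρ = mk⇔
      (λ { (size≡k , crit) → let j∈ , bare = to critical⇔ crit; q≤ , ρ≡ = to (bare⇔ s ρ) bare in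
                             (q≤ , trans (sym (total ρ≡)) size≡k) , j∈ , ρ≡ })
      (λ { ((q≤ , size≡k) , j∈ , ρ≡) → trans (total ρ≡) size≡k
                                     , from critical⇔ (j∈ , from (bare⇔ s ρ) (q≤ , ρ≡)) })
      where
      open ≡-Reasoning
      critical⇔ = critical-representative⇔ j p v s ρ
      total : ∣ ρ ∣ ≡ suc b → ∣ p ∷ v ∷ (s ++ ρ) ∣ ≡ (e + suc b) + ∣ s ∣
      total ρ≡ = begin
        ∣ p ∷ v ∷ (s ++ ρ) ∣  ≡⟨ size (s ++ ρ) ⟩
        e + ∣ s ++ ρ ∣        ≡⟨ cong (e +_) (∣p++q∣ s ρ) ⟩
        e + (∣ s ∣ + ∣ ρ ∣)   ≡⟨ cong (λ x → e + (∣ s ∣ + x)) ρ≡ ⟩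
        e + (∣ s ∣ + suc b)   ≡⟨ cong (e +_) (+-comm ∣ s ∣ (suc b)) ⟩
        e + (suc b + ∣ s ∣)   ≡⟨ +-assoc e (suc b) ∣ s ∣ ⟨
        (e + suc b) + ∣ s ∣   ∎

representative-index : ∀ {r} → r ∈ representatives → ∃[ j ] (r ≡ suc (suc (100 ↑ʳ j)))
representative-index (there (there r∈)) = map₂ (cong (λ i → suc (suc i))) (⊥++⁻ 100 r∈)
  where
  ⊥++⁻ : ∀ m {n} {q : Subset n} {i : Fin (m + n)} → i ∈ (⊥ {m} ++ q) → ∃[ j ] (i ≡ m ↑ʳ j)
  ⊥++⁻ zero    {i = i} _          = i , refl
  ⊥++⁻ (suc m) (there i∈) with j , refl ← ⊥++⁻ m i∈ = j , refl

-- Numerical comparison of the formulas.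

-- Stated for arbitrary numbers, so that it can be decided on the formulas and then transported to
-- the counts.
Comparison : (v r : ℕ) → ℕ → Set
Comparison v r k =
  (v ≡ 0 → r ≡ 0) ×
  (v ≢ 0 →
     (270 ≤ k × k ≤ 487) ×
     ((270 ≤ k × k ≤ 356) ⊎ (380 ≤ k × k ≤ 487) → v > r) ×
     (357 ≤ k × k ≤ 379 → r > v))

comparison? : ∀ v r k → Dec (Comparison v r k)
comparison? v r k =
  (v ≟ 0 →-dec r ≟ 0) ×-dec
  (¬? (v ≟ 0) →-dec
     (270 ≤? k ×-dec k ≤? 487) ×-dec
     (((270 ≤? k ×-dec k ≤? 356) ⊎-dec (380 ≤? k ×-dec k ≤? 487)) →-dec r <? v) ×-dec
     ((357 ≤? k ×-dec k ≤? 379) →-dec v <? r))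

-- A finite check by evaluation; 487 = 52 + 435 is the largest size at which `c-v-formula` can be
-- nonzero.
comparison-below-488 : ∀ {k} → k < 488 → Comparison (c-v-formula k) (c-r-formula k) k
comparison-below-488 = from-yes (allUpTo? (λ k → comparison? (c-v-formula k) (c-r-formula k) k) 488)

c-v-vanishes : ∀ {k} → 487 < k → c-v-formula k ≡ 0
c-v-vanishes {k} k> = trans (cong ((100 C 50) *_) (#≥-vanishes 435 218 52 k>)) (*-zeroʳ (100 C 50))

c-r-vanishes : ∀ {k} → 487 < k → c-r-formula k ≡ 0
-- Each offset plus all 100 senators is at most 391, well below 487.
c-r-vanishes {k} k> = cong₂ _+_ (cong₂ _+_ (zeros 67 290 (m≤m+n 390 97)) (zeros 67 291 (m≤m+n 391 96)))
                                (cong₂ _+_ (zeros 51 219 (m≤m+n 319 168)) (zeros 50 220 (m≤m+n 320 167)))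
  where
  zeros : ∀ q c {b} → c + 100 ≤ 487 → #≥ 100 q c k * b ≡ 0
  zeros q c {b} c≤ = cong (_* b) (#≥-vanishes 100 q c (≤-<-trans c≤ k>))

comparison : ∀ k → Comparison (c-v-formula k) (c-r-formula k) k
-- The explicit {k} spares a unification problem that would unroll the product
-- (100 C 50) * _ in unary.
comparison k = [ (λ k<488 → comparison-below-488 {k} k<488) , above ]′ (<-≤-connex k 488)
  where
  above : 487 < k → Comparison (c-v-formula k) (c-r-formula k) k
  above 487<k = (λ _ → c-r-vanishes 487<k) , λ v≢0 → contradiction (c-v-vanishes 487<k) v≢0

criticalCount-vicePresident : ∀ k → criticalCount vicePresident k ≡ c-v-formula k
criticalCount-vicePresident k =
  count-critical-vicePresident k (λ T → ∣ T ∣ ≟ k ×-dec critical? vicePresident T)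

criticalCount-representative : ∀ {r} → ∃[ j ] (r ≡ suc (suc (100 ↑ʳ j))) →
                               ∀ k → criticalCount r k ≡ c-r-formula k
criticalCount-representative (j , refl) k =
  count-critical-representative j k (λ T → ∣ T ∣ ≟ k ×-dec critical? (suc (suc (100 ↑ʳ j))) T)

comparison-of-counts : ∀ r → r ∈ representatives → ∀ k →
                       Comparison (criticalCount vicePresident k) (criticalCount r k) k
comparison-of-counts r r∈ k =
  subst (λ x → Comparison x (criticalCount r k) k) (sym (criticalCount-vicePresident k))
    (subst (λ x → Comparison (c-v-formula k) x k) (sym (criticalCount-representative (representative-index r∈) k))
      (comparison k))

proposition8 :
    (r : Player) → r ∈ representatives →
    let c-v = criticalCount vicePresident
        c-r = criticalCount r
    in
    (∀ k → c-v k ≡ 0 → c-r k ≡ 0) ×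
    (∀ k → c-v k ≢ 0 →
       (270 ≤ k × k ≤ 487) ×
       ((270 ≤ k × k ≤ 356) ⊎ (380 ≤ k × k ≤ 487) → c-v k > c-r k) ×
       (357 ≤ k × k ≤ 379 → c-r k > c-v k))
proposition8 r r∈ = (λ k → proj₁ (comparison-of-counts r r∈ k)) , (λ k → proj₂ (comparison-of-counts r r∈ k))
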